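{- Let $m,b$ be integers with $m\ge3$ and $b\ge3$, and let $\mathbf t_{b,m}$ be the generalized Thue–Morse word. Then (1) $S(\mathbf t_{b,m})$ is almost $I_2'(m)$-rich; (2) if $m$ is odd or $b$ is odd, then $S(\mathbf t_{b,m})$ is $I_2'(m)$-rich.
   Context: Alphabet $\mathbb Z_m=\{0,\dots,m-1\}$, all letter arithmetic modulo $m$. $\mathbf t_{b,m}=(s_b(n)\bmod m)_{n\ge0}$, where $s_b(n)$ is the sum of the digits of $n$ in base $b$. The map $S$ on (finite nonempty or infinite) words over $\mathbb Z_m$ is $S(w_0w_1w_2\cdots)=v_1v_2\cdots$ with $v_i=(w_{i-1}+w_i)\bmod m$. For $x\in\mathbb Z_m$, $\Psi_x$ is the antimorphism determined by $\Psi_x(k)=x-k$ on letters ($\Psi_x(w_0\cdots w_n)=\Psi_x(w_n)\cdots\Psi_x(w_0)$) and $\Pi_x$ is the morphism with $\Pi_x(k)=x+k$. $I_2'(m)=\{\Psi_{2x}:x\in\mathbb Z_m\}\cup\{\Pi_{2x}:x\in\mathbb Z_m\}$. For a finite group $G$ of morphisms and antimorphisms containing an antimorphism: the orbit of $w$ is $[w]=\{\mu(w):\mu\in G\}$; $p$ is a $G$-palindrome if $\Psi(p)=p$ for some antimorphism $\Psi\in G$; for a finite word $w$, $\mathrm{Pal}^G(w)$ is the set of orbits $[p]$ with $p$ a $G$-palindromic factor of $w$ (the empty word included), $\gamma_G(w)$ is the number of orbits $[a]$ of letters $a$ occurring in $w$ with $a\neq\Psi(a)$ for every antimorphism $\Psi\in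 G$, and $D^G(w)=|w|+1-\#\mathrm{Pal}^G(w)-\gamma_G(w)$. For an infinite word $\mathbf u$, $D^G(\mathbf u)=\sup\{D^G(w): w \text{ a factor of }\mathbf u\}$; $\mathbf u$ is $G$-rich if $D^G(\mathbf u)=0$ and almost $G$-rich if $D^G(\mathbf u)<\infty$. -}

module Defs where

open import Data.Nat using (ℕ; zero; suc; _+_; _*_; _∸_; _≤_)
open import Data.Nat.DivMod using (_%_; _/_)
import Data.Nat.Properties as ℕP
open import Data.Integer as ℤ using (ℤ; +_; _-_)
open import Data.List using (List; []; _∷_; map; reverse; upTo; length; filter; concatMap; inits; tails; deduplicate)
open import Data.List.Properties using (≡-dec)
open import Data.List.Relation.Unary.Any using (any?)
open import Data.List.Relation.Unary.All using (all?)
open import Data.List.Relation.Unary.Any using (Any)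
open import Data.List.Relation.Unary.All using (All)
open import Data.Product using (Σ; _×_; _,_)
open import Relation.Binary.PropositionalEquality using (_≡_; _≢_)
open import Relation.Nullary using (Dec; ¬?)

-- reduction modulo m (identity for m = 0; only m ≥ 3 is used)
modN : ℕ → ℕ → ℕ
modN zero    a = a
modN (suc k) a = a % suc k

-- digit sum s_b(n) in base b (b ≥ 2; for b < 2 an arbitrary value 0)
digitSum : ℕ → ℕ → ℕ
digitSum (suc (suc k)) n = go n n
  where
  go : ℕ → ℕ → ℕ
  go zero    _ = 0
  go (suc f) zero = 0
  go (suc f) (suc n) = suc n % suc (suc k) + go f (suc n / suc (suc k))
digitSum _ _ = 0

-- infinite words over Z_m as functions ℕ → ℕ (letters in {0,…,m-1})
Word : Set
Word = ℕ → ℕ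

tbm : ℕ → ℕ → Word
tbm b m n = modN m (digitSum b n)

S : ℕ → Word → Word
S m u n = modN m (u n + u (suc n))

-- elements of I_2'(m): psi x stands for Ψ_{2x}, pi x for Π_{2x}
data Elem : Set where
  psi : ℕ → Elem
  pi  : ℕ → Elem

act : ℕ → Elem → List ℕ → List ℕ
act m (psi x) w = reverse (map (λ k → modN m (2 * x + (m ∸ modN m k))) w)
act m (pi x)  w = map (λ k → modN m (2 * x + k)) w

group : ℕ → List Elem
group m = concatMap (λ x → psi x ∷ pi x ∷ []) (upTo m)

antis : ℕ → List Elem
antis m = map psi (upTo m)

SameOrbit : ℕ → List ℕ → List ℕ → Set
SameOrbit m p q = Any (λ μ → act m μ p ≡ q) (group m)

sameOrbit? : ∀ m p q → Dec (SameOrbit m p q)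
sameOrbit? m p q = any? (λ μ → ≡-dec ℕP._≟_ (act m μ p) q) (group m)

IsGPal : ℕ → List ℕ → Set
IsGPal m p = Any (λ Ψ → act m Ψ p ≡ p) (antis m)

isGPal? : ∀ m p → Dec (IsGPal m p)
isGPal? m p = any? (λ Ψ → ≡-dec ℕP._≟_ (act m Ψ p) p) (antis m)

-- all factors of a finite word (with repetitions; includes the empty word)
factors : List ℕ → List (List ℕ)
factors w = concatMap inits (tails w)

numOrbits : ℕ → List (List ℕ) → ℕ
numOrbits m ws = length (deduplicate (sameOrbit? m) ws)

numPal : ℕ → List ℕ → ℕ
numPal m w = numOrbits m (filter (isGPal? m) (factors w))

NonPalLetter : ℕ → ℕ → Set
NonPalLetter m a = All (λ Ψ → act m Ψ (a ∷ []) ≢ (a ∷ [])) (antis m)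

nonPalLetter? : ∀ m a → Dec (NonPalLetter m a)
nonPalLetter? m a = all? (λ Ψ → ¬? (≡-dec ℕP._≟_ (act m Ψ (a ∷ [])) (a ∷ []))) (antis m)

gamma : ℕ → List ℕ → ℕ
gamma m w = numOrbits m (map (λ a → a ∷ []) (filter (nonPalLetter? m) w))

defect : ℕ → List ℕ → ℤ
defect m w = (+ (length w + 1) - + numPal m w) - + gamma m w

factorAt : Word → ℕ → ℕ → List ℕ
factorAt u i n = map (λ j → u (i + j)) (upTo n)

-- G-rich: D^G(u) = sup_w D^G(w) = 0 (the empty factor has defect 0)
Rich : ℕ → Word → Set
Rich m u = ∀ i n → defect m (factorAt u i n) ℤ.≤ + 0

AlmostRich : ℕ → Word → Set
AlmostRich m u = Σ ℕ λ K → ∀ i n → defect m (factorAt u i n) ℤ.≤ + K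

Odd : ℕ → Set
Odd n = n % 2 ≡ 1

{-# OPTIONS --safe #-}

-- Let V n = s(n) + 1 - s(n+1) modulo m, which vanishes unless b divides n + 1 and satisfies
-- V(b k + b - 1) = V k + (b - 1).  Consecutive letters of u = S(t) differ by 2 - (V n + V(n+1)), so windows of u
-- are determined up to translation by D n = V n + V(n+1), and a palindromic window of V is a G-palindromic
-- window of u: there u x + u y = 2 (s(x) + s(y+1)), which is constant and even.
--
-- Every window of V has a palindromic suffix that does not recur earlier in the window, by desubstitution: shorten
-- the window to the block ends it contains, with equal margins, and lift a suffix found one level up.  The lifted
-- suffix is recognised by a nonzero letter; if it has none, a run of zeros serves instead.  For suffixes of length at
-- least 2 an occurrence in D is an occurrence in V, as at most one of three consecutive letters of V is nonzero.
-- Hence each prefix of a window of u contributes a new orbit of G-palindromes, except when its last letter is a value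
-- of V not seen before, which happens at most m times.  If m or b is odd, the last two letters of u contribute a new
-- orbit in that case too.

module Submission where

open import Defs
open import Data.Nat as ℕ using (ℕ; zero; suc; z≤n; s≤s; _≤_)
import Data.Nat.Properties as ℕ
import Data.Nat.DivMod as ℕ
import Data.Nat.Divisibility as ℕ
open import Data.Nat.Induction using (<-rec)
open import Algebra.Properties.CommutativeSemigroup ℕ.+-commutativeSemigroup using (x∙yz≈y∙xz)
open import Data.List using (List; []; _∷_; _++_; map; reverse; upTo; applyUpTo; applyDownFrom; length; filter; inits; tails; deduplicate; head)
open import Data.List.Properties using (map-upTo; map-applyUpTo; reverse-applyUpTo; reverse-map; reverse-involutive; map-∘; map-cong; length-++; length-map; length-upTo; ∷-injective)
open import Data.List.Membership.Propositional using (_∈_; lose)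
open import Data.List.Membership.Propositional.Properties using (∈-∃++; ∈-filter⁺; ∈-filter⁻; ∈-upTo⁺; ∈-concatMap⁺; ∈-map⁺; ∈-++⁻; ∈-++⁺ˡ; ∈-++⁺ʳ)
open import Data.List.Relation.Unary.Any using (here; there; satisfied)
import Data.List.Relation.Unary.Any.Properties as Any
open import Data.List.Relation.Unary.All as All using (All; []; _∷_)
open import Data.List.Relation.Unary.AllPairs using ([]; _∷_)
open import Data.List.Relation.Unary.Unique.Propositional using (Unique)
open import Data.Maybe using (fromMaybe)
open import Data.Product using (∃; ∃₂; _×_; _,_; proj₁; proj₂)
open import Data.Sum using (_⊎_; inj₁; inj₂; [_,_]′)
open import Function using (_∘_)
open import Relation.Nullary using (¬_; Dec; yes; no; ¬?; contradiction)
open import Relation.Nullary.Decidable using (map′)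
open import Relation.Binary using (IsEquivalence; Decidable)
open import Relation.Binary.PropositionalEquality

-- Digit sums: recursion on the last digit.

module Desubstitution where
  open import Data.Nat
  open import Data.Nat.Properties
  open import Data.Nat.DivMod
  open import Data.Nat.Solver using (module +-*-Solver)

  -- The local function of digitSum has no name in Defs; it is recovered here by unification.
  mutual
    digits : ℕ → ℕ → ℕ → ℕ → ℕ
    digits = _

    digitSum-unfold : ∀ k n → digitSum (suc (suc k)) (suc n) ≡
      suc n % suc (suc k) + digits k (suc n) n (suc n / suc (suc k))
    -- Abstracting `suc n` and the quotient makes the arguments of `digits` distinct variables, so
    -- unification has a unique solution.
    digitSum-unfold k n with suc n | suc n / suc (suc k)
    ... | N | q = refl

  private
    suc/≤ : ∀ k n → suc n / suc (suc k) ≤ n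
    suc/≤ k n = s≤s⁻¹ (m/n<m (suc n) (suc (suc k)) (s≤s (s≤s z≤n)))

    -- `N` is the argument captured from `digitSum` and `f` is fuel. Dividing by a base of at least
    -- 2 decreases a positive number, so fuel bounding the number never runs out.
    digits-fuel : ∀ k N N′ f f′ n → n ≤ f → n ≤ f′ → digits k N f n ≡ digits k N′ f′ n
    digits-fuel k N N′ zero    zero     zero p q = refl
    digits-fuel k N N′ zero    (suc f′) zero p q = refl
    digits-fuel k N N′ (suc f) zero     zero p q = refl
    digits-fuel k N N′ (suc f) (suc f′) zero p q = refl
    digits-fuel k N N′ (suc f) (suc f′) (suc n) (s≤s p) (s≤s q) =
      cong (suc n % suc (suc k) +_)
        (digits-fuel k N N′ f f′ (suc n / suc (suc k))
          (≤-trans (suc/≤ k n) p) (≤-trans (suc/≤ k n) q))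

  digitSum-divMod : ∀ k n → digitSum (suc (suc k)) n ≡
    n % suc (suc k) + digitSum (suc (suc k)) (n / suc (suc k))
  digitSum-divMod k zero    = refl
  digitSum-divMod k (suc n) = trans (digitSum-unfold k n)
    (cong (suc n % suc (suc k) +_) (digits-fuel k (suc n) (suc n / suc (suc k)) n (suc n / suc (suc k)) (suc n / suc (suc k)) (suc/≤ k n) ≤-refl))

  digitSum-digit : ∀ c r k → 1 ≤ c → r ≤ c → digitSum (suc c) (r + k * suc c) ≡ r + digitSum (suc c) k
  digitSum-digit (suc c) r k (s≤s _) r≤c = trans (digitSum-divMod c (r + k * b))
    (cong₂ (λ x y → x + digitSum b y) rem quo)
    where
    b = suc (suc c)
    rem : (r + k * b) % b ≡ r
    rem = trans ([m+kn]%n≡m%n r k b) (m<n⇒m%n≡m (s≤s r≤c))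
    quo : (r + k * b) / b ≡ k
    quo = begin
      (r + k * b) / b        ≡⟨ +-distrib-/ r (k * b) (subst (_< b) (sym eq) (s≤s r≤c)) ⟩
      r / b + k * b / b      ≡⟨ cong₂ _+_ (m<n⇒m/n≡0 (s≤s r≤c)) (m*n/n≡m k b) ⟩
      k                      ∎
      where
      open ≡-Reasoning
      eq : r % b + k * b % b ≡ r
      eq = trans (cong₂ _+_ (m<n⇒m%n≡m (s≤s r≤c)) (m*n%n≡0 k b)) (+-identityʳ r)

  -- Blocks of length `b` and the arithmetic of their last positions.

  module Blocks (c : ℕ) where

    b : ℕ
    b = suc c

    -- last position of the k-th block of length b
    B : ℕ → ℕ
    B k = c + k * b

    -- The split is by carries: passing from n to n + 1 in base `b` carries exactly at the block
    -- ends.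
    data View : ℕ → Set where
      inner : ∀ k r → r < c → View (r + k * b)
      final : ∀ k → View (B k)

    view : ∀ n → View n
    view n = subst View (sym (m≡m%n+[m/n]*n n b)) (digit (n / b) (m≤n⇒m<n∨m≡n (s≤s⁻¹ (m%n<n n b))))
      where
      digit : ∀ {r} k → r < c ⊎ r ≡ c → View (r + k * b)
      digit k (inj₁ r<c) = inner k _ r<c
      digit k (inj₂ refl) = final k

    remainder-unique : ∀ {r r′} q q′ → r ≤ c → r′ ≤ c → r + q * b ≡ r′ + q′ * b → r ≡ r′
    remainder-unique {r} {r′} q q′ r≤c r′≤c eq = begin
      r                  ≡⟨ m<n⇒m%n≡m (s≤s r≤c) ⟨
      r % b              ≡⟨ [m+kn]%n≡m%n r q b ⟨
      (r + q * b) % b    ≡⟨ cong (_% b) eq ⟩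
      (r′ + q′ * b) % b  ≡⟨ [m+kn]%n≡m%n r′ q′ b ⟩
      r′ % b             ≡⟨ m<n⇒m%n≡m (s≤s r′≤c) ⟩
      r′                 ∎
      where open ≡-Reasoning

    B-mono-≤ : ∀ {h k} → h ≤ k → B h ≤ B k
    B-mono-≤ h≤k = +-monoʳ-≤ c (*-monoˡ-≤ b h≤k)

    B-cancel-< : ∀ {h k} → B h < B k → h < k
    B-cancel-< Bh<Bk = ≰⇒> (λ k≤h → <⇒≱ Bh<Bk (B-mono-≤ k≤h))

    start≤B⇒≤ : ∀ {h k} → k * b ≤ B h → k ≤ h
    start≤B⇒≤ {h} {k} p = s≤s⁻¹ (*-cancelʳ-< b k (suc h) (s≤s p))

    -- Block ends are `c + 1` apart, so moving at most `c` to the right of `B k` does not reach the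
    -- next one.
    B≤+B⇒≤ : ∀ {h k ρ} → ρ ≤ c → B h ≤ ρ + B k → h ≤ k
    B≤+B⇒≤ {h} {k} {ρ} ρ≤c p = start≤B⇒≤ {k} {h} (+-cancelˡ-≤ c (h * b) (B k) (≤-trans p (+-monoˡ-≤ (B k) ρ≤c)))

    B-+ : ∀ h t → B (h + t) ≡ B h + t * b
    B-+ h t = trans (cong (c +_) (*-distribʳ-+ b h t)) (sym (+-assoc c (h * b) (t * b)))

    B-index : ∀ {h h′ p q} → B h + B h′ ≡ B p + B q → h + h′ ≡ p + q
    B-index {h} {h′} {p} {q} eq = *-cancelʳ-≡ (h + h′) (p + q) b
      (+-cancelˡ-≡ (c + c) _ _ (trans (sym (lem h h′)) (trans eq (lem p q))))
      where
      lem : ∀ x y → B x + B y ≡ c + c + (x + y) * b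
      lem x y = solve 3 (λ c x y → c :+ x :* (con 1 :+ c) :+ (c :+ y :* (con 1 :+ c)) :=
                                 c :+ c :+ (x :+ y) :* (con 1 :+ c)) refl c x y
        where open +-*-Solver

    -- Every block end is `c` modulo `b`, hence so is `x`. This keeps reflections and recurrences
    -- aligned with blocks.
    B-complement : ∀ {x h p q} → x + B h ≡ B p + B q → ∃ λ w → x ≡ B w
    B-complement {x} {h} {p} {q} eq with view x
    ... | final w = w , refl
    ... | inner k r r<c = contradiction
      (remainder-unique (k + h) (p + q) (<⇒≤ r<c) ≤-refl (+-cancelʳ-≡ c _ _
        (trans (lem r k) (trans eq (sym (lem c p))))))
      (<⇒≢ r<c)
      where
      lem : ∀ {y} r x → r + (x + y) * b + c ≡ r + x * b + B y
      lem {y} r x = solve 4 (λ c x y r → r :+ (x :+ y) :* (con 1 :+ c) :+ c :=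
                                 r :+ x :* (con 1 :+ c) :+ (c :+ y :* (con 1 :+ c))) refl c x y r
        where open +-*-Solver

    /≤⇒≤B : ∀ {x h} → x / b ≤ h → x ≤ B h
    /≤⇒≤B {x} {h} p = ≤-trans (≤-reflexive (m≡m%n+[m/n]*n x b))
      (≤-trans (+-monoˡ-≤ (x / b * b) (s≤s⁻¹ (m%n<n x b))) (B-mono-≤ p))

    ≤B⇒/≤ : ∀ {x h} → x ≤ B h → x / b ≤ h
    ≤B⇒/≤ {x} {h} p = s≤s⁻¹ (m<n*o⇒m/o<n {x} {suc h} {b} (s≤s p))

    -- `ρ` is the distance from `e` back to the last block end; the first alternative holds when no
    -- block has ended yet.
    locate : ∀ e → e < c ⊎ ∃₂ λ k ρ → ρ ≤ c × e ≡ ρ + B k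
    locate e with view e
    ... | inner zero r r<c rewrite +-identityʳ r = inj₁ r<c
    ... | inner (suc k) r r<c = inj₂ (k , suc r , r<c , +-suc r (B k))
    ... | final k = inj₂ (k , 0 , z≤n , refl)

  -- Palindromic windows and their recurrences.

  module Window {A : Set} (_≈_ : A → A → Set) (V : ℕ → A) where

    Palindromic : ℕ → ℕ → Set
    Palindromic a e = ∀ x y → a ≤ x → a ≤ y → x + y ≡ a + e → V x ≈ V y

    Recurs : ℕ → ℕ → ℕ → Set
    Recurs j a e = ∀ t → a + t ≤ e → V (j + t) ≈ V (a + t)

    -- The nonempty unioccurrent palindromic suffix of the theory of rich words: an occurrence
    -- starting before `a` also ends before `e`.
    FreshSuffix : ℕ → ℕ → Set
    FreshSuffix i e = ∃ λ a → i ≤ a × a ≤ e × Palindromic a e × (∀ j → i ≤ j → j < a → ¬ Recurs j a e)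

  reflect≤ : ∀ {a e x y} → a ≤ y → x + y ≡ a + e → x ≤ e
  reflect≤ {a} {e} {x} {y} a≤y eq = +-cancelʳ-≤ y x e
    (≤-trans (≤-reflexive (trans eq (+-comm a e))) (+-monoʳ-≤ e a≤y))

  -- Existence of fresh palindromic suffixes by desubstitution.

  module SuffixPalindromes
    (c : ℕ) (1≤c : 1 ≤ c)
    {A : Set} (_≈_ : A → A → Set) (isEq : IsEquivalence _≈_) (_≈?_ : Decidable _≈_)
    (z : A) (V : ℕ → A)
    -- Together these make `V` desubstitutable: block ends spell an injectively relabelled copy of
    -- `V`, separated by runs of `z`.
    (V-inner : ∀ k r → r < c → V (r + k * suc c) ≈ z)
    (V-cong : ∀ h k → V h ≈ V k → V (c + h * suc c) ≈ V (c + k * suc c))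
    (V-injective : ∀ h k → V (c + h * suc c) ≈ V (c + k * suc c) → V h ≈ V k)
    (V-isolated : ∀ k → V (c + k * suc c) ≈ z → ¬ V (c + suc k * suc c) ≈ z)
    where

    open Blocks c
    open Window _≈_ V
    open IsEquivalence isEq renaming (refl to ≈-refl; sym to ≈-sym; trans to ≈-trans)

    Constant : ℕ → ℕ → Set
    Constant a e = ∀ x → a ≤ x → x ≤ e → V x ≈ z

    constant⇒palindromic : ∀ {a e} → Constant a e → Palindromic a e
    constant⇒palindromic {a} {e} p x y a≤x a≤y eq = ≈-trans
      (p x a≤x (reflect≤ a≤y eq)) (≈-sym (p y a≤y (reflect≤ a≤x (trans (+-comm y x) eq))))

    whole : ∀ {i e} → i ≤ e → Constant i e → FreshSuffix i e
    whole {i} i≤e p = i , ≤-refl , i≤e , constant⇒palindromic p , λ j i≤j j<i → contradiction i≤j (<⇒≱ j<i)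

    run : ∀ {k ρ} → ρ ≤ c → V (B k) ≈ z → Constant (k * b) (ρ + B k)
    run {k} {ρ} ρ≤c p x lo hi with view x
    ... | inner h r r<c = V-inner h r r<c
    ... | final h = subst (λ h → V (B h) ≈ z) (≤-antisym (start≤B⇒≤ {h} {k} lo) (B≤+B⇒≤ {h} {k} ρ≤c hi)) p

    gap : ∀ {k ρ} → ρ ≤ c → Constant (suc (B k)) (ρ + B k)
    gap {k} {ρ} ρ≤c x lo hi with view x
    ... | inner h r r<c = V-inner h r r<c
    ... | final h = contradiction (B≤+B⇒≤ {h} {k} ρ≤c hi) (<⇒≱ (B-cancel-< {k} {h} lo))

    -- Both margins, before `B a′` and after `B k`, have length `ρ`, so the lifted window has the
    -- same centre as its block ends and inherits the symmetry. The non-`z` letter at `B h` forces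
    -- every recurrence into alignment, after which `V-injective` carries it back one level up.
    lift : ∀ {i ρ k a a′ h} → ρ ≤ c → a + ρ ≡ B a′ → i + ρ ≤ B a′ →
      Palindromic a′ k → (∀ j → (i + ρ) / b ≤ j → j < a′ → ¬ Recurs j a′ k) →
      a′ ≤ h → h ≤ k → ¬ V (B h) ≈ z → FreshSuffix i (ρ + B k)
    lift {i} {ρ} {k} {a} {a′} {h} ρ≤c aρ iρ pal new a′≤h h≤k Bh≉z =
      a , i≤a , a≤e , pal′ , new′
      where
      i≤a : i ≤ a
      i≤a = +-cancelʳ-≤ ρ i a (≤-trans iρ (≤-reflexive (sym aρ)))
      a≤Ba′ : a ≤ B a′
      a≤Ba′ = ≤-trans (m≤m+n a ρ) (≤-reflexive aρ)
      a≤Bh : a ≤ B h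
      a≤Bh = ≤-trans a≤Ba′ (B-mono-≤ a′≤h)
      Bh≤e : B h ≤ ρ + B k
      Bh≤e = ≤-trans (B-mono-≤ h≤k) (m≤n+m (B k) ρ)
      a≤e : a ≤ ρ + B k
      a≤e = ≤-trans a≤Bh Bh≤e
      centre : ∀ {s} → s ≡ a + (ρ + B k) → s ≡ B a′ + B k
      centre eq = trans eq (trans (sym (+-assoc a ρ (B k))) (cong (_+ B k) aρ))
      low : ∀ {p} → a ≤ B p → a′ ≤ p
      low {p} a≤Bp = B≤+B⇒≤ ρ≤c (≤-trans (≤-reflexive (sym aρ)) (≤-trans (+-monoˡ-≤ ρ a≤Bp) (≤-reflexive (+-comm (B p) ρ))))
      pal′ : Palindromic a (ρ + B k)
      pal′ x y a≤x a≤y eq with view x | view y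
      ... | inner p r r<c | inner q s s<c = ≈-trans (V-inner p r r<c) (≈-sym (V-inner q s s<c))
      ... | final p | final q = V-cong p q (pal p q (low a≤x) (low a≤y) (B-index {p} {q} {a′} {k} (centre eq)))
      -- Reflection maps block ends to block ends, so the mixed cases are impossible.
      ... | final p | inner q s s<c with B-complement {s + q * b} {p} {a′} {k} (trans (+-comm _ (B p)) (centre eq))
      ...   | w , e′ = contradiction (remainder-unique q w (<⇒≤ s<c) ≤-refl e′) (<⇒≢ s<c)
      pal′ x y a≤x a≤y eq | inner q s s<c | final p with B-complement {s + q * b} {p} {a′} {k} (centre eq)
      ...   | w , e′ = contradiction (remainder-unique q w (<⇒≤ s<c) ≤-refl e′) (<⇒≢ s<c)
      -- The non-z letter at B h can only recur at the end of a block, so recurrences are aligned with blocks.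
      new′ : ∀ j → i ≤ j → j < a → ¬ Recurs j a (ρ + B k)
      new′ j i≤j j<a rec = aligned
        where
        t = B h ∸ a
        at : a + t ≡ B h
        at = m+[n∸m]≡n a≤Bh
        hit : V (j + t) ≈ V (B h)
        hit = subst (λ n → V (j + t) ≈ V n) at (rec t (≤-trans (≤-reflexive at) Bh≤e))
        final′ : ∃ λ h₁ → j + t ≡ B h₁
        final′ with j + t | hit | view (j + t)
        ... | _ | _ | final h₁ = h₁ , refl
        ... | _ | q | inner p r r<c = contradiction (≈-trans (≈-sym q) (V-inner p r r<c)) Bh≉z
        aligned : _
        aligned with final′
        ... | h₁ , jt with B-complement {j + ρ} {h} {h₁} {a′}
                       (trans (cong (j + ρ +_) (sym at)) (trans (lem j ρ a t) (cong₂ _+_ jt aρ)))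
          where
          lem : ∀ j ρ a t → j + ρ + (a + t) ≡ j + t + (a + ρ)
          lem = solve 4 (λ j ρ a t → j :+ ρ :+ (a :+ t) := j :+ t :+ (a :+ ρ)) refl
            where open +-*-Solver
        ...   | j′ , jρ = new j′
          (≤B⇒/≤ {i + ρ} {j′} (≤-trans (+-monoˡ-≤ ρ i≤j) (≤-reflexive jρ)))
          (B-cancel-< (subst₂ _<_ jρ aρ (+-monoˡ-< ρ j<a)))
          -- The offsets `ρ + s * b` pick out the block ends of both occurrences.
          λ s a′s → V-injective (j′ + s) (a′ + s) (subst₂ (λ m n → V m ≈ V n) (shift j′ jρ s) (shift a′ aρ s)
            (rec (ρ + s * b) (≤-trans (≤-reflexive (shift a′ aρ s)) (≤-trans (B-mono-≤ a′s) (m≤n+m (B k) ρ)))))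
          where
          shift : ∀ {x} x′ → x + ρ ≡ B x′ → ∀ s → x + (ρ + s * b) ≡ B (x′ + s)
          shift {x} x′ eq s = trans (sym (+-assoc x ρ (s * b))) (trans (cong (_+ s * b) eq) (sym (B-+ x′ s)))

    -- Serves when the suffix found one level up is a single letter lifting to `z`, which leaves no
    -- letter to align by. The replacement is the run of `z` from the start of block `k`; it has
    -- length `c + ρ + 1`, so every occurrence covers some block end.
    runSuffix : ∀ {i ρ k} → ρ ≤ c → i + ρ ≤ B k → V (B k) ≈ z →
      (∀ j → (i + ρ) / b ≤ j → j < k → ¬ V (B j) ≈ z) → FreshSuffix i (ρ + B k)
    runSuffix {i} {ρ} {k} ρ≤c iρ Bk≈z new with k * b ≤? i
    ... | yes kb≤i = whole (≤-trans (m≤m+n i ρ) (≤-trans iρ (m≤n+m (B k) ρ)))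
      (λ x lo → run {k} ρ≤c Bk≈z x (≤-trans kb≤i lo))
    ... | no kb≰i = k * b , <⇒≤ (≰⇒> kb≰i) , ≤-trans (m≤n+m (k * b) c) (m≤n+m (B k) ρ) ,
        constant⇒palindromic (run {k} ρ≤c Bk≈z) , new′ k new Bk≈z
      where
      zeroAt : ∀ {k j} → V (B k) ≈ z → Recurs j (k * b) (ρ + B k) →
        ∀ h → j ≤ B h → B h ≤ c + (j + ρ) → V (B h) ≈ z
      zeroAt {k} {j} Bk≈z rec h lo hi = letterAt (m+[n∸m]≡n lo)
        where
        letterAt : ∀ {t} → j + t ≡ B h → V (B h) ≈ z
        letterAt {t} jt = ≈-trans (subst (λ n → V n ≈ V (k * b + t)) jt (rec t t≤))
          (run {k} ρ≤c Bk≈z (k * b + t) (m≤m+n (k * b) t) t≤)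
          where
          t≤c+ρ : t ≤ c + ρ
          t≤c+ρ = +-cancelˡ-≤ j t (c + ρ) (≤-trans (≤-reflexive jt) (≤-trans hi (≤-reflexive (x∙yz≈y∙xz c j ρ))))
          t≤ : k * b + t ≤ ρ + B k
          t≤ = ≤-trans (+-monoʳ-≤ (k * b) t≤c+ρ) (≤-reflexive (trans (+-comm (k * b) (c + ρ))
            (trans (cong (_+ k * b) (+-comm c ρ)) (+-assoc ρ c (k * b)))))
      new′ : ∀ k → (∀ j → (i + ρ) / b ≤ j → j < k → ¬ V (B j) ≈ z) → V (B k) ≈ z →
        ∀ j → i ≤ j → j < k * b → ¬ Recurs j (k * b) (ρ + B k)
      new′ (suc k) new Bk≈z j i≤j j<kb rec with (j + ρ) / b <? suc k
      -- The end of the block containing `j + ρ` lies inside the occurrence, so an earlier block end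
      -- would carry `z`.
      ... | yes h<k = new ((j + ρ) / b) (/-monoˡ-≤ b (+-monoˡ-≤ ρ i≤j)) h<k
          (zeroAt {suc k} Bk≈z rec ((j + ρ) / b) (≤-trans (m≤m+n j ρ) (/≤⇒≤B {j + ρ} ≤-refl))
            (+-monoʳ-≤ c (m/n*n≤m (j + ρ) b)))
      -- Here the occurrence starts in the preceding block or earlier but covers the end of that
      -- block, giving `z` at two consecutive block ends.
      ... | no h≮k = V-isolated k (zeroAt {suc k} Bk≈z rec k (s≤s⁻¹ j<kb) (≤-trans Bk≤j+ρ (m≤n+m (j + ρ) c))) Bk≈z
        where
        Bk≤j+ρ : B k ≤ j + ρ
        Bk≤j+ρ = ≮⇒≥ (λ j+ρ<Bk → h≮k (s≤s (≤B⇒/≤ (<⇒≤ j+ρ<Bk))))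

    -- Induction on `e`, split by whether a left margin of length `ρ` fits between `i` and the last
    -- block end `B k`. If it does not, the window is short enough for an explicit run of `z`; if it
    -- does, the hypothesis is applied to block indices.
    suffix : ∀ e → (∀ {k} → k < e → ∀ i → i ≤ k → FreshSuffix i k) → ∀ i → i ≤ e → FreshSuffix i e
    suffix e ih i i≤e with locate e
    ... | inj₁ e<c = whole i≤e initial
      where
      initial : Constant i e
      initial x _ x≤e with view x
      ... | inner h r r<c = V-inner h r r<c
      ... | final h = contradiction (≤-trans (m≤m+n c (h * b)) x≤e) (<⇒≱ e<c)
    ... | inj₂ (k , ρ , ρ≤c , refl) with i + ρ ≤? B k | V (B k) ≈? z
    ...   | no iρ≰ | yes Bk≈z = whole i≤e (λ x i≤x → run {k} ρ≤c Bk≈z x (≤-trans kb≤i i≤x))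
      where
      kb≤i : k * b ≤ i
      kb≤i = +-cancelˡ-≤ c (k * b) i (≤-trans (<⇒≤ (≰⇒> iρ≰)) (≤-trans (+-monoʳ-≤ i ρ≤c) (≤-reflexive (+-comm i c))))
    ...   | no iρ≰ | no Bk≉z with i ≤? B k
    ...     | no i≰ = whole i≤e (λ x i≤x → gap {k} ρ≤c x (≤-trans (≰⇒> i≰) i≤x))
    -- The suffix is the run of `z` after `B k`. Since `i + ρ` exceeds `B k`, an earlier occurrence
    -- would cover the non-`z` letter at `B k`.
    ...     | yes i≤Bk = suc (B k) , m≤n⇒m≤1+n i≤Bk , +-monoˡ-≤ (B k) 1≤ρ ,
          constant⇒palindromic (gap {k} ρ≤c) , new
      where
      1≤ρ : 1 ≤ ρ
      1≤ρ = +-cancelˡ-≤ (B k) 1 ρ (≤-trans (≤-reflexive (+-comm (B k) 1)) (≤-trans (≰⇒> iρ≰) (+-monoˡ-≤ ρ i≤Bk)))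
      new : ∀ j → i ≤ j → j < suc (B k) → ¬ Recurs j (suc (B k)) (ρ + B k)
      new j i≤j (s≤s j≤Bk) rec = Bk≉z (letterAt (m+[n∸m]≡n j≤Bk))
        where
        letterAt : ∀ {t} → j + t ≡ B k → V (B k) ≈ z
        letterAt {t} jt = ≈-trans (subst (λ n → V n ≈ V (suc (B k) + t)) jt (rec t t≤))
          (gap {k} ρ≤c (suc (B k) + t) (m≤m+n (suc (B k)) t) t≤)
          where
          t<ρ : t < ρ
          t<ρ = +-cancelˡ-< j t ρ (≤-trans (s≤s (≤-reflexive jt)) (≤-trans (≰⇒> iρ≰) (+-monoˡ-≤ ρ i≤j)))
          t≤ : suc (B k) + t ≤ ρ + B k
          t≤ = ≤-trans (≤-reflexive (trans (sym (+-suc (B k) t)) (+-comm (B k) (suc t)))) (+-monoˡ-≤ (B k) t<ρ)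
    suffix e ih i i≤e | inj₂ (k , ρ , ρ≤c , refl) | yes iρ | nonzero?
      -- `(i + ρ) / b` is the first block whose end leaves room for a left margin of length `ρ`.
      with ih {k} k<e ((i + ρ) / b) (≤B⇒/≤ iρ)
      where
      k<e : k < ρ + B k
      k<e = ≤-trans (+-mono-≤ 1≤c (m≤m*n k b)) (m≤n+m (B k) ρ)
    ... | a , i≤a , a≤k , pal , new = go nonzero?
      where
      ρ≤Ba : ρ ≤ B a
      ρ≤Ba = ≤-trans ρ≤c (m≤m+n c (a * b))
      go : Dec (V (B k) ≈ z) → FreshSuffix i (ρ + B k)
      go (no Bk≉z) = lift ρ≤c (m∸n+n≡m ρ≤Ba) (/≤⇒≤B i≤a) pal new a≤k ≤-refl Bk≉z
      -- When `B k` carries `z`, the preceding block end does not, and it anchors the lift provided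
      -- the suffix has at least two letters.
      go (yes Bk≈z) with m≤n⇒m<n∨m≡n a≤k
      ... | inj₂ refl = runSuffix {k = k} ρ≤c iρ Bk≈z λ j i≤j j<k Bj≈z → new j i≤j j<k
            λ t k+t≤k → subst (λ t → V (j + t) ≈ V (k + t)) (sym (n≤0⇒n≡0 (+-cancelˡ-≤ k t 0 (≤-trans k+t≤k (≤-reflexive (sym (+-identityʳ k)))))))
              (subst₂ (λ j k → V j ≈ V k) (sym (+-identityʳ j)) (sym (+-identityʳ k))
                (V-injective j k (≈-trans Bj≈z (≈-sym Bk≈z))))
      ... | inj₁ (s≤s {n = k′} a≤k′) = lift ρ≤c (m∸n+n≡m ρ≤Ba) (/≤⇒≤B i≤a) pal new a≤k′ (n≤1+n k′)
            (λ Bk′≈z → V-isolated k′ Bk′≈z Bk≈z)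

    freshSuffix : ∀ e i → i ≤ e → FreshSuffix i e
    freshSuffix = <-rec _ suffix

open Desubstitution
open import Data.Integer as ℤ using (ℤ; +_; -_; _+_; _-_; _*_; 0ℤ; 1ℤ; _%ℕ_; _/ℕ_)
import Data.Integer.Properties as ℤ
open import Data.Integer.DivMod using (n%ℕd<d; a≡a%ℕn+[a/ℕn]*n)
open import Data.Integer.Divisibility.Signed using (_∣_; divides; _∣?_; ∣⇒∣ᵤ; ∣m⇒∣-m; ∣m∣n⇒∣m+n; ∣m∣n⇒∣m-n; ∣n⇒∣m*n)
open import Data.Integer.Tactic.RingSolver using (solve-∀)

-- Congruence of integers modulo `m`.

module Congruence (m : ℕ) where

  infix 4 _≈_ _≈?_

  -- A record lets `x` and `y` be inferred, which the bare difference `x - y` would not.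
  record _≈_ (x y : ℤ) : Set where
    constructor congruent
    field divisible : + m ∣ x - y

  open _≈_ public

  _≈?_ : Decidable _≈_
  x ≈? y = map′ congruent divisible (+ m ∣? (x - y))

  by : ∀ {x y d} → x - y ≡ d → + m ∣ d → x ≈ y
  by eq d = congruent (subst (+ m ∣_) (sym eq) d)

  ≈-reflexive : ∀ {x y} → x ≡ y → x ≈ y
  ≈-reflexive {x} refl = by (ℤ.+-inverseʳ x) (divides 0ℤ refl)

  ≈-refl : ∀ {x} → x ≈ x
  ≈-refl = ≈-reflexive refl

  ≈-sym : ∀ {x y} → x ≈ y → y ≈ x
  ≈-sym {x} {y} p = by (lem x y) (∣m⇒∣-m (divisible p))
    where
    lem : ∀ x y → y - x ≡ - (x - y)
    lem = solve-∀

  ≈-trans : ∀ {x y z} → x ≈ y → y ≈ z → x ≈ z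
  ≈-trans {x} {y} {z} p q = by (lem x y z) (∣m∣n⇒∣m+n (divisible p) (divisible q))
    where
    lem : ∀ x y z → x - z ≡ (x - y) + (y - z)
    lem = solve-∀

  ≈-isEquivalence : IsEquivalence _≈_
  ≈-isEquivalence = record { refl = ≈-refl ; sym = ≈-sym ; trans = ≈-trans }

  +-cong : ∀ {x x′ y y′} → x ≈ x′ → y ≈ y′ → x + y ≈ x′ + y′
  +-cong {x} {x′} {y} {y′} p q = by (lem x x′ y y′) (∣m∣n⇒∣m+n (divisible p) (divisible q))
    where
    lem : ∀ x x′ y y′ → x + y - (x′ + y′) ≡ (x - x′) + (y - y′)
    lem = solve-∀

  +-congˡ : ∀ z {x y} → x ≈ y → z + x ≈ z + y
  +-congˡ z = +-cong (≈-refl {z})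

  +-congʳ : ∀ z {x y} → x ≈ y → x + z ≈ y + z
  +-congʳ z p = +-cong p (≈-refl {z})

  neg-cong : ∀ {x y} → x ≈ y → - x ≈ - y
  neg-cong {x} {y} p = by (lem x y) (∣m⇒∣-m (divisible p))
    where
    lem : ∀ x y → - x - - y ≡ - (x - y)
    lem = solve-∀

  +-cancelʳ : ∀ {x y} z → x + z ≈ y + z → x ≈ y
  +-cancelʳ {x} {y} z p = by (lem x y z) (divisible p)
    where
    lem : ∀ x y z → x - y ≡ x + z - (y + z)
    lem = solve-∀

  *-congˡ : ∀ k {x y} → x ≈ y → k * x ≈ k * y
  *-congˡ k {x} {y} p = by (lem k x y) (∣n⇒∣m*n k (divisible p))
    where
    lem : ∀ k x y → k * x - k * y ≡ k * (x - y)
    lem = solve-∀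

  modulus≈0 : + m ≈ 0ℤ
  modulus≈0 = by (ℤ.+-identityʳ (+ m)) (divides 1ℤ (lem (+ m)))
    where
    lem : ∀ x → x ≡ 1ℤ * x
    lem = solve-∀

-- The carry sequence `V` and the sums `D` of its neighbouring letters.

module Carries (c : ℕ) (2≤c : 2 ℕ.≤ c) (m : ℕ) where

  open Blocks c
  open Congruence m

  s : ℕ → ℕ
  s = digitSum b

  -- c times the number of carries in n + 1, over ℤ
  V : ℕ → ℤ
  V n = + suc (s n) - + s (suc n)

  open Window _≈_ V

  1≤c : 1 ℕ.≤ c
  1≤c = ℕ.<⇒≤ 2≤c

  V-inner : ∀ k r → r ℕ.< c → V (r ℕ.+ k ℕ.* b) ≡ 0ℤ
  V-inner k r r<c rewrite digitSum-digit c r k 1≤c (ℕ.<⇒≤ r<c) | digitSum-digit c (suc r) k 1≤c r<c =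
    ℤ.+-inverseʳ (+ suc (r ℕ.+ s k))

  -- `B k` is `k` followed by the digit `c`, and its successor is `suc k` followed by the digit 0.
  V-final : ∀ k → V (B k) ≡ V k + + c
  V-final k = begin
    + suc (s (B k)) - + s (suc k ℕ.* b) ≡⟨ cong₂ (λ x y → + suc x - + y) (digitSum-digit c c k 1≤c ℕ.≤-refl)
                                                (digitSum-digit c 0 (suc k) 1≤c z≤n) ⟩
    + (suc c ℕ.+ s k) - + s (suc k)     ≡⟨ cong (_- + s (suc k)) (trans (cong +_ (sym (ℕ.+-suc c (s k)))) (ℤ.pos-+ c (suc (s k)))) ⟩
    + c + + suc (s k) - + s (suc k)     ≡⟨ lem (+ c) (+ suc (s k)) (+ s (suc k)) ⟩
    V k + + c                           ∎
    where
    open ≡-Reasoning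
    lem : ∀ x y z → x + y - z ≡ y - z + x
    lem = solve-∀

  -- `V` can be nonzero only at block ends, and these are `c + 1` apart.
  V-sparse : ∀ n d → 1 ℕ.≤ d → d ℕ.≤ c → V n ≡ 0ℤ ⊎ V (d ℕ.+ n) ≡ 0ℤ
  V-sparse n d 1≤d d≤c = split (view n)
    where
    next : ∀ {k x} → x ≡ d ℕ.+ B k → View x → V x ≡ 0ℤ
    next eq (inner h r r<c) = V-inner h r r<c
    next {k} eq (final h) = contradiction
      (B≤+B⇒≤ {h} {k} d≤c (ℕ.≤-reflexive eq))
      (ℕ.<⇒≱ (B-cancel-< {k} {h} (ℕ.≤-trans (ℕ.+-monoˡ-≤ (B k) 1≤d) (ℕ.≤-reflexive (sym eq)))))
    split : ∀ {n} → View n → V n ≡ 0ℤ ⊎ V (d ℕ.+ n) ≡ 0ℤ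
    split (inner k r r<c) = inj₁ (V-inner k r r<c)
    split (final k) = inj₂ (next {k} refl (view (d ℕ.+ B k)))

  V-cong : ∀ h k → V h ≈ V k → V (B h) ≈ V (B k)
  V-cong h k p rewrite V-final h | V-final k = +-cong p ≈-refl

  V-injective : ∀ h k → V (B h) ≈ V (B k) → V h ≈ V k
  V-injective h k p rewrite V-final h | V-final k = +-cancelʳ (+ c) p

  -- One of `V k` and `V (suc k)` is 0, so one of the two block ends carries `c` itself.
  V-isolated : ¬ + c ≈ 0ℤ → ∀ k → V (B k) ≈ 0ℤ → ¬ V (B (suc k)) ≈ 0ℤ
  V-isolated c≉0 k p q rewrite V-final k | V-final (suc k) with V-sparse k 1 ℕ.≤-refl 1≤c
  ... | inj₁ e rewrite e = c≉0 p
  ... | inj₂ e rewrite e = c≉0 q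

  -- By desubstitution all values of `V` are multiples of `c`. In this degenerate case block ends
  -- are not isolated, but every window is constant modulo `m` and serves as its own suffix.
  V-trivial : + c ≈ 0ℤ → ∀ n → V n ≈ 0ℤ
  V-trivial c≈0 = <-rec _ λ n rec → step n rec (view n)
    where
    step : ∀ n → (∀ {k} → k ℕ.< n → V k ≈ 0ℤ) → View n → V n ≈ 0ℤ
    step _ rec (inner k r r<c) = ≈-reflexive (V-inner k r r<c)
    step _ rec (final k) rewrite V-final k =
      +-cong (rec {k} (ℕ.+-mono-≤ 1≤c (ℕ.m≤m*n k b))) c≈0

  freshSuffix : ∀ i e → i ℕ.≤ e → FreshSuffix i e
  freshSuffix i e i≤e with + c ≈? 0ℤ
  ... | yes c≈0 = i , ℕ.≤-refl , i≤e , (λ x y _ _ _ → ≈-trans (V-trivial c≈0 x) (≈-sym (V-trivial c≈0 y)))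
        , λ j i≤j j<i → contradiction i≤j (ℕ.<⇒≱ j<i)
  ... | no c≉0 = SuffixPalindromes.freshSuffix c 1≤c _≈_ ≈-isEquivalence _≈?_ 0ℤ V
        (λ k r r<c → ≈-reflexive (V-inner k r r<c)) V-cong V-injective (V-isolated c≉0) e i i≤e

  -- Multiples of `c` are even modulo `m` as soon as `c` is. This supplies the centres of two-letter
  -- G-palindromes.
  V-halves : ∃ (λ d → + c ≈ + 2 * d) → ∀ n → ∃ λ d → V n ≈ + 2 * d
  V-halves (h , c≈2h) = <-rec _ λ n rec → step n rec (view n)
    where
    step : ∀ n → (∀ {k} → k ℕ.< n → ∃ λ d → V k ≈ + 2 * d) → View n → ∃ λ d → V n ≈ + 2 * d
    step _ rec (inner k r r<c) = 0ℤ , ≈-reflexive (V-inner k r r<c)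
    step _ rec (final k) rewrite V-final k with rec {k} (ℕ.+-mono-≤ 1≤c (ℕ.m≤m*n k b))
    ... | d , p = d + h , ≈-trans (+-cong p c≈2h) (≈-reflexive (lem d h))
      where
      lem : ∀ d h → + 2 * d + + 2 * h ≡ + 2 * (d + h)
      lem = solve-∀

  D : ℕ → ℤ
  D n = V n + V (suc n)

  D-one : ∀ n → D n ≡ V n ⊎ D n ≡ V (suc n)
  D-one n with V-sparse n 1 ℕ.≤-refl 1≤c
  ... | inj₁ e rewrite e = inj₂ (ℤ.+-identityˡ (V (suc n)))
  ... | inj₂ e rewrite e = inj₁ (ℤ.+-identityʳ (V n))

  -- Sparsity is applied at distance 2 as well as 1, hence the need for `2 ≤ c`, that is, base at
  -- least 3.
  twoZeros : ∀ n → (V n ≡ 0ℤ × V (suc n) ≡ 0ℤ) ⊎ (V n ≡ 0ℤ × V (2 ℕ.+ n) ≡ 0ℤ) ⊎ (V (suc n) ≡ 0ℤ × V (2 ℕ.+ n) ≡ 0ℤ)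
  twoZeros n with V-sparse n 1 ℕ.≤-refl 1≤c | V-sparse n 2 (s≤s z≤n) 2≤c | V-sparse (suc n) 1 ℕ.≤-refl 1≤c
  ... | inj₁ p | _      | inj₁ q = inj₁ (p , q)
  ... | inj₁ p | _      | inj₂ q = inj₂ (inj₁ (p , q))
  ... | inj₂ p | inj₁ q | _      = inj₁ (q , p)
  ... | inj₂ p | inj₂ q | _      = inj₂ (inj₂ (p , q))

  D-cancelˡ : ∀ {j a} → D j ≈ D a → V j ≈ V a → V (suc j) ≈ V (suc a)
  D-cancelˡ {j} {a} p q = by (lem (V j) (V (suc j)) (V a) (V (suc a))) (∣m∣n⇒∣m-n (divisible p) (divisible q))
    where
    lem : ∀ x x′ y y′ → x′ - y′ ≡ (x + x′ - (y + y′)) - (x - y)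
    lem = solve-∀

  D-cancelʳ : ∀ {j a} → D j ≈ D a → V (suc j) ≈ V (suc a) → V j ≈ V a
  D-cancelʳ {j} {a} p q = by (lem (V j) (V (suc j)) (V a) (V (suc a))) (∣m∣n⇒∣m-n (divisible p) (divisible q))
    where
    lem : ∀ x x′ y y′ → x - y ≡ (x + x′ - (y + y′)) - (x′ - y′)
    lem = solve-∀

  -- `D` determines `V` once one letter is known. A palindromic window of length 2 has equal letters
  -- of which one vanishes, so it consists of zeros; a longer window is settled by a common zero.
  D-recurs-first : ∀ {a e j} → Palindromic a e → suc a ℕ.≤ e →
    (∀ t → suc (a ℕ.+ t) ℕ.≤ e → D (j ℕ.+ t) ≈ D (a ℕ.+ t)) → V j ≈ V a
  D-recurs-first {a} {e} {j} pal a<e rec with ℕ.m≤n⇒m<n∨m≡n a<e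
  ... | inj₂ refl = ≈-trans Vj≈0 (≈-sym Va≈0)
    where
    mirror : V a ≈ V (suc a)
    mirror = pal a (suc a) ℕ.≤-refl (ℕ.n≤1+n a) refl
    Va≈0 : V a ≈ 0ℤ
    Va≈0 with V-sparse a 1 ℕ.≤-refl 1≤c
    ... | inj₁ p = ≈-reflexive p
    ... | inj₂ p = ≈-trans mirror (≈-reflexive p)
    Dj≈0 : D j ≈ 0ℤ
    Dj≈0 = ≈-trans (subst₂ (λ j a → D j ≈ D a) (ℕ.+-identityʳ j) (ℕ.+-identityʳ a) (rec 0 (s≤s (ℕ.≤-reflexive (ℕ.+-identityʳ a)))))
      (+-cong Va≈0 (≈-trans (≈-sym mirror) Va≈0))
    Vj≈0 : V j ≈ 0ℤ
    Vj≈0 with V-sparse j 1 ℕ.≤-refl 1≤c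
    ... | inj₁ p = ≈-reflexive p
    ... | inj₂ p = ≈-trans (≈-reflexive (trans (sym (ℤ.+-identityʳ (V j))) (cong (_+_ (V j)) (sym p)))) Dj≈0
  -- Among three consecutive letters at most one is nonzero, so V[j..j+2] and V[a..a+2] share a zero.
  ... | inj₁ a+2≤e = share (twoZeros j) (twoZeros a)
    where
    D₀ : D j ≈ D a
    D₀ = subst₂ (λ j a → D j ≈ D a) (ℕ.+-identityʳ j) (ℕ.+-identityʳ a) (rec 0 (ℕ.≤-trans (s≤s (ℕ.≤-reflexive (ℕ.+-identityʳ a))) a<e))
    D₁ : D (suc j) ≈ D (suc a)
    D₁ = subst₂ (λ j a → D j ≈ D a) (ℕ.+-comm j 1) (ℕ.+-comm a 1) (rec 1 (ℕ.≤-trans (s≤s (ℕ.≤-reflexive (ℕ.+-comm a 1))) a+2≤e))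
    both : ∀ {x y} → x ≡ 0ℤ → y ≡ 0ℤ → x ≈ y
    both p q = ≈-reflexive (trans p (sym q))
    at₀ : V j ≡ 0ℤ → V a ≡ 0ℤ → V j ≈ V a
    at₀ = both
    at₁ : V (suc j) ≡ 0ℤ → V (suc a) ≡ 0ℤ → V j ≈ V a
    at₁ p q = D-cancelʳ D₀ (both p q)
    at₂ : V (2 ℕ.+ j) ≡ 0ℤ → V (2 ℕ.+ a) ≡ 0ℤ → V j ≈ V a
    at₂ p q = D-cancelʳ D₀ (D-cancelʳ D₁ (both p q))
    share : _ → _ → V j ≈ V a
    share (inj₁ (p , _))        (inj₁ (q , _))        = at₀ p q
    share (inj₁ (p , _))        (inj₂ (inj₁ (q , _))) = at₀ p q
    share (inj₁ (_ , p))        (inj₂ (inj₂ (q , _))) = at₁ p q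
    share (inj₂ (inj₁ (p , _))) (inj₁ (q , _))        = at₀ p q
    share (inj₂ (inj₁ (p , _))) (inj₂ (inj₁ (q , _))) = at₀ p q
    share (inj₂ (inj₁ (_ , p))) (inj₂ (inj₂ (_ , q))) = at₂ p q
    share (inj₂ (inj₂ (p , _))) (inj₁ (_ , q))        = at₁ p q
    share (inj₂ (inj₂ (_ , p))) (inj₂ (inj₁ (_ , q))) = at₂ p q
    share (inj₂ (inj₂ (_ , p))) (inj₂ (inj₂ (_ , q))) = at₂ p q

  D-recurs⇒recurs : ∀ {a e j} → Palindromic a e → suc a ℕ.≤ e →
    (∀ t → suc (a ℕ.+ t) ℕ.≤ e → D (j ℕ.+ t) ≈ D (a ℕ.+ t)) → Recurs j a e
  D-recurs⇒recurs {a} {e} {j} pal a<e rec zero _ =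
    subst₂ (λ j a → V j ≈ V a) (sym (ℕ.+-identityʳ j)) (sym (ℕ.+-identityʳ a)) (D-recurs-first pal a<e rec)
  D-recurs⇒recurs {a} {e} {j} pal a<e rec (suc t) a+t≤e rewrite ℕ.+-suc j t | ℕ.+-suc a t =
    D-cancelˡ (rec t a+t≤e) (D-recurs⇒recurs pal a<e rec t (ℕ.<⇒≤ a+t≤e))

  -- If `V (suc e)` is 0, a recurrence is impossible because every pair of neighbours contains a 0.
  -- Otherwise `V e` is 0 and `D e` is the new letter, while `D j` is one of two letters strictly
  -- before it.
  D-fresh : ∀ {i e} → (∀ j → i ℕ.≤ j → j ℕ.< suc e → ¬ V j ≈ V (suc e)) →
    ∀ j → i ℕ.≤ j → j ℕ.< e → ¬ D j ≈ D e
  D-fresh {i} {e} new j i≤j j<e p with V-sparse e 1 ℕ.≤-refl 1≤c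
  ... | inj₂ Ve⁺≡0 with V-sparse j 1 ℕ.≤-refl 1≤c
  ...   | inj₁ q = new j i≤j (ℕ.m≤n⇒m≤1+n j<e) (≈-reflexive (trans q (sym Ve⁺≡0)))
  ...   | inj₂ q = new (suc j) (ℕ.m≤n⇒m≤1+n i≤j) (s≤s j<e) (≈-reflexive (trans q (sym Ve⁺≡0)))
  D-fresh {i} {e} new j i≤j j<e p | inj₁ Ve≡0 with D-one j
  ...   | inj₁ q = new j i≤j (ℕ.m≤n⇒m≤1+n j<e) (≈-trans (≈-reflexive (sym q)) (≈-trans p De))
    where
    De : D e ≈ V (suc e)
    De = ≈-reflexive (trans (cong (_+ V (suc e)) Ve≡0) (ℤ.+-identityˡ (V (suc e))))
  ...   | inj₂ q = new (suc j) (ℕ.m≤n⇒m≤1+n i≤j) (s≤s j<e) (≈-trans (≈-reflexive (sym q)) (≈-trans p De))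
    where
    De : D e ≈ V (suc e)
    De = ≈-reflexive (trans (cong (_+ V (suc e)) Ve≡0) (ℤ.+-identityˡ (V (suc e))))

-- Lists: counting distinct elements, factors, and windows of infinite words.

unique-⊆⇒length≤ : ∀ {A : Set} {xs ys : List A} → Unique xs → (∀ {x} → x ∈ xs → x ∈ ys) → length xs ℕ.≤ length ys
unique-⊆⇒length≤ [] sub = z≤n
unique-⊆⇒length≤ {xs = x ∷ xs} {ys} (x∉ ∷ uniq) sub with ∈-∃++ (sub (here refl))
... | as , bs , refl = ℕ.≤-trans (s≤s (unique-⊆⇒length≤ uniq sub′)) (ℕ.≤-reflexive len)
  where
  sub′ : ∀ {y} → y ∈ xs → y ∈ as ++ bs
  sub′ y∈ with ∈-++⁻ as (sub (there y∈))
  ... | inj₁ p = ∈-++⁺ˡ p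
  ... | inj₂ (here refl) = contradiction refl (All.lookup x∉ y∈)
  ... | inj₂ (there p) = ∈-++⁺ʳ as p
  len : suc (length (as ++ bs)) ≡ length (as ++ x ∷ bs)
  len = trans (cong suc (length-++ as)) (trans (sym (ℕ.+-suc (length as) (length bs))) (sym (length-++ as)))

-- An element is removed only in favour of a related one, whose `κ` is the same, so no value of `κ`
-- is lost.
∈-map-deduplicate : ∀ {A K : Set} {R : A → A → Set} (R? : Decidable R) {P : A → Set} (κ : A → K) →
  (∀ {x y} → P x → R x y → κ x ≡ κ y) → ∀ {xs x} → All P xs → x ∈ xs → κ x ∈ map κ (deduplicate R? xs)
∈-map-deduplicate R? κ inv (px ∷ pxs) (here refl) = here refl
∈-map-deduplicate {R = R} R? κ inv {y ∷ ys} {x} (py ∷ pys) (there x∈) = keep (∈-map-deduplicate R? κ inv pys x∈)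
  where
  drop : ∀ {v zs} → v ∈ map κ zs → v ∈ map κ (y ∷ filter (λ z → ¬? (R? y z)) zs)
  drop {zs = z ∷ zs} v∈ with R? y z | v∈
  ... | yes r | here refl = here (sym (inv py r))
  ... | no _  | here refl = there (here refl)
  ... | yes _ | there p   = drop p
  ... | no _  | there p   with drop p
  ...   | here q  = here q
  ...   | there q = there (there q)
  keep : κ x ∈ map κ (deduplicate R? ys) → κ x ∈ map κ (deduplicate R? (y ∷ ys))
  keep = drop

∈-inits : ∀ {A : Set} (xs ys : List A) → xs ∈ inits (xs ++ ys)
∈-inits []       ys = here refl
∈-inits (x ∷ xs) ys with ∈-inits xs ys
... | here refl = there (here refl)
... | there p   = there (there (∈-map⁺ (x ∷_) p))

∈-tails : ∀ {A : Set} (xs ys : List A) → ys ∈ tails (xs ++ ys)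
∈-tails []       ys = here refl
∈-tails (x ∷ xs) ys = there (∈-tails xs ys)

∈-factors : ∀ xs ys zs → ys ∈ factors (xs ++ ys ++ zs)
∈-factors xs ys zs = ∈-concatMap⁺ inits (lose (∈-tails xs (ys ++ zs)) (∈-inits ys zs))

applyUpTo-+ : ∀ {A : Set} (f : ℕ → A) p q → applyUpTo f (p ℕ.+ q) ≡ applyUpTo f p ++ applyUpTo (λ t → f (p ℕ.+ t)) q
applyUpTo-+ f zero    q = refl
applyUpTo-+ f (suc p) q = cong (f 0 ∷_) (applyUpTo-+ (λ t → f (suc t)) p q)

applyUpTo-cong : ∀ {A : Set} {f g : ℕ → A} n → (∀ t → f t ≡ g t) → applyUpTo f n ≡ applyUpTo g n
applyUpTo-cong zero    eq = refl
applyUpTo-cong (suc n) eq = cong₂ _∷_ (eq 0) (applyUpTo-cong n (eq ∘ suc))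

applyUpTo-injective : ∀ {A : Set} {f g : ℕ → A} n n′ → applyUpTo f n ≡ applyUpTo g n′ →
  n ≡ n′ × (∀ t → t ℕ.< n → f t ≡ g t)
applyUpTo-injective zero    zero     eq = refl , λ t ()
applyUpTo-injective (suc n) (suc n′) eq with ∷-injective eq
... | hd , tl with applyUpTo-injective n n′ tl
...   | refl , rec = refl , λ { zero _ → hd ; (suc t) (s≤s t<n) → rec t t<n }

applyDownFrom-reflect : ∀ {A : Set} {f g : ℕ → A} n → (∀ x y → suc (x ℕ.+ y) ≡ n → f x ≡ g y) →
  applyDownFrom f n ≡ applyUpTo g n
applyDownFrom-reflect zero    eq = refl
applyDownFrom-reflect (suc n) eq = cong₂ _∷_ (eq n 0 (cong suc (ℕ.+-identityʳ n)))
  (applyDownFrom-reflect n (λ x y e → eq x (suc y) (cong suc (trans (ℕ.+-suc x y) e))))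

factorAt-applyUpTo : ∀ u i n → factorAt u i n ≡ applyUpTo (λ t → u (i ℕ.+ t)) n
factorAt-applyUpTo u i n = map-upTo (λ t → u (i ℕ.+ t)) n

∈-factors-factorAt : ∀ u {i n j L} → i ℕ.≤ j → j ℕ.+ L ℕ.≤ i ℕ.+ n → factorAt u j L ∈ factors (factorAt u i n)
∈-factors-factorAt u {i} {n} {j} {L} i≤j hi with ℕ.m≤n⇒∃[o]m+o≡n i≤j
... | k , refl with ℕ.m≤n⇒∃[o]m+o≡n (ℕ.+-cancelˡ-≤ i (k ℕ.+ L) n (ℕ.≤-trans (ℕ.≤-reflexive (sym (ℕ.+-assoc i k L))) hi))
...   | r , refl = subst₂ (λ p w → p ∈ factors w) (sym (factorAt-applyUpTo u (i ℕ.+ k) L)) (sym split) (∈-factors (applyUpTo v k) _ (applyUpTo (λ t → v (k ℕ.+ (L ℕ.+ t))) r))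
  where
  v : ℕ → ℕ
  v t = u (i ℕ.+ t)
  split : factorAt u i (k ℕ.+ L ℕ.+ r) ≡
    applyUpTo v k ++ applyUpTo (λ t → u (i ℕ.+ k ℕ.+ t)) L ++ applyUpTo (λ t → v (k ℕ.+ (L ℕ.+ t))) r
  split = begin
    factorAt u i (k ℕ.+ L ℕ.+ r)         ≡⟨ factorAt-applyUpTo u i (k ℕ.+ L ℕ.+ r) ⟩
    applyUpTo v (k ℕ.+ L ℕ.+ r)          ≡⟨ cong (applyUpTo v) (ℕ.+-assoc k L r) ⟩
    applyUpTo v (k ℕ.+ (L ℕ.+ r))        ≡⟨ applyUpTo-+ v k (L ℕ.+ r) ⟩
    applyUpTo v k ++ applyUpTo (λ t → v (k ℕ.+ t)) (L ℕ.+ r)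
                                         ≡⟨ cong (applyUpTo v k ++_) (applyUpTo-+ (λ t → v (k ℕ.+ t)) L r) ⟩
    applyUpTo v k ++ applyUpTo (λ t → v (k ℕ.+ t)) L ++ applyUpTo (λ t → v (k ℕ.+ (L ℕ.+ t))) r
                                         ≡⟨ cong (λ p → applyUpTo v k ++ p ++ applyUpTo (λ t → v (k ℕ.+ (L ℕ.+ t))) r) (applyUpTo-cong L (λ t → cong u (sym (ℕ.+-assoc i k t)))) ⟩
    _                                    ∎
    where open ≡-Reasoning

-- Orbits of G-palindromes and a key separating them.

module Orbits (m′ : ℕ) where

  m : ℕ
  m = suc m′

  open Congruence m

  multiple≈0 : ∀ q → q * + m ≈ 0ℤ
  multiple≈0 q = by (ℤ.+-identityʳ (q * + m)) (divides q refl)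

  %ℕ-≈ : ∀ x → + (x %ℕ m) ≈ x
  %ℕ-≈ x = ≈-sym (subst (_≈ + (x %ℕ m)) (sym (a≡a%ℕn+[a/ℕn]*n x m))
    (≈-trans (+-congˡ (+ (x %ℕ m)) (multiple≈0 (x /ℕ m))) (≈-reflexive (ℤ.+-identityʳ (+ (x %ℕ m))))))

  modN-≈ : ∀ a → + modN m a ≈ + a
  modN-≈ a = %ℕ-≈ (+ a)

  modN-< : ∀ a → modN m a ℕ.< m
  modN-< a = ℕ.m%n<n a m

  ≈⇒≡ : ∀ {a c} → a ℕ.< m → c ℕ.< m → + a ≈ + c → a ≡ c
  ≈⇒≡ {a} {c} a<m c<m p = [ (λ a≤c → ordered a≤c c<m p) , (λ c≤a → sym (ordered c≤a a<m (≈-sym p))) ]′ (ℕ.≤-total a c)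
    where
    ordered : ∀ {a c} → a ℕ.≤ c → c ℕ.< m → + a ≈ + c → a ≡ c
    ordered {a} {c} a≤c c<m p = ℕ.≤-antisym a≤c (ℕ.m∸n≡0⇒m≤n (small (c ℕ.∸ a) (ℕ.≤-<-trans (ℕ.m∸n≤m c a) c<m) m∣c∸a))
      where
      m∣c∸a : m ℕ.∣ c ℕ.∸ a
      m∣c∸a = subst (m ℕ.∣_) (trans (cong ℤ.∣_∣ (ℤ.m-n≡m⊖n a c)) (ℤ.∣⊖∣-≤ a≤c)) (∣⇒∣ᵤ (divisible p))
      small : ∀ d → d ℕ.< m → m ℕ.∣ d → d ≡ 0
      small zero    _   _   = refl
      small (suc d) d<m m∣d = contradiction (ℕ.∣⇒≤ m∣d) (ℕ.<⇒≱ d<m)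

  complement-≈ : ∀ k → + (m ℕ.∸ modN m k) ≈ - + k
  complement-≈ k = ≈-trans (≈-reflexive (trans (sym (ℤ.⊖-≥ r≤m)) (sym (ℤ.m-n≡m⊖n m r))))
      (≈-trans (+-cong modulus≈0 (neg-cong (modN-≈ k))) (≈-reflexive (ℤ.+-identityˡ (- + k))))
    where
    r = modN m k
    r≤m : r ℕ.≤ m
    r≤m = ℕ.<⇒≤ (modN-< k)

  difference : ℕ → ℕ → ℕ
  difference h k = modN m (k ℕ.+ (m ℕ.∸ modN m h))

  difference-≈ : ∀ h k → + difference h k ≈ + k - + h
  difference-≈ h k = ≈-trans (modN-≈ (k ℕ.+ (m ℕ.∸ modN m h)))
    (≈-trans (≈-reflexive (ℤ.pos-+ k (m ℕ.∸ modN m h))) (+-congˡ (+ k) (complement-≈ h)))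

  -- The word translated to begin with 0. For even `m` it may identify different orbits, which can
  -- only lower a count of keys; distinct keys of G-palindromes always mean distinct orbits.
  κ : List ℕ → List ℕ
  κ w = map (difference (fromMaybe 0 (head w))) w

  κ-translate : ∀ (τ : ℕ → ℕ) C → (∀ k → + τ k ≈ + k + C) → ∀ w → κ (map τ w) ≡ κ w
  κ-translate τ C tr []       = refl
  κ-translate τ C tr w@(x ∷ xs) = trans (sym (map-∘ w)) (map-cong shift w)
    where
    lem : ∀ k x C → k + C - (x + C) ≡ k - x
    lem = solve-∀
    shift : ∀ k → difference (τ x) (τ k) ≡ difference x k
    shift k = ≈⇒≡ (modN-< (τ k ℕ.+ (m ℕ.∸ modN m (τ x)))) (modN-< (k ℕ.+ (m ℕ.∸ modN m x)))
      (≈-trans (difference-≈ (τ x) (τ k))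
      (≈-trans (+-cong (tr k) (neg-cong (tr x)))
      (≈-trans (≈-reflexive (lem (+ k) (+ x) C)) (≈-sym (difference-≈ x k)))))

  private
    ψ : ℕ → ℕ → ℕ
    ψ x k = modN m (2 ℕ.* x ℕ.+ (m ℕ.∸ modN m k))

  ψ-≈ : ∀ x k → + ψ x k ≈ + (2 ℕ.* x) - + k
  ψ-≈ x k = ≈-trans (modN-≈ (2 ℕ.* x ℕ.+ (m ℕ.∸ modN m k)))
    (≈-trans (≈-reflexive (ℤ.pos-+ (2 ℕ.* x) (m ℕ.∸ modN m k))) (+-congˡ (+ (2 ℕ.* x)) (complement-≈ k)))

  -- An antimorphism acts on a G-palindrome as a translation, because p = Ψ(p) undoes the reversal.
  κ-orbit : ∀ {p q} → IsGPal m p → SameOrbit m p q → κ p ≡ κ q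
  κ-orbit {p} {q} pal orb with satisfied (Any.map⁻ pal) | satisfied orb
  ... | _      | pi x , refl = sym (κ-translate (λ k → modN m (2 ℕ.* x ℕ.+ k)) (+ (2 ℕ.* x)) tr p)
    where
    tr : ∀ k → + modN m (2 ℕ.* x ℕ.+ k) ≈ + k + + (2 ℕ.* x)
    tr k = ≈-trans (modN-≈ (2 ℕ.* x ℕ.+ k)) (≈-reflexive (trans (cong +_ (ℕ.+-comm (2 ℕ.* x) k)) (ℤ.pos-+ k (2 ℕ.* x))))
  ... | x , fix | psi y , refl = sym (trans (cong κ collapse) (κ-translate (ψ y ∘ ψ x) (+ (2 ℕ.* y) - + (2 ℕ.* x)) tr p))
    where
    collapse : reverse (map (ψ y) p) ≡ map (ψ y ∘ ψ x) p
    collapse = begin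
      reverse (map (ψ y) p)                          ≡⟨ cong (λ w → reverse (map (ψ y) w)) fix ⟨
      reverse (map (ψ y) (reverse (map (ψ x) p)))    ≡⟨ cong reverse (reverse-map (ψ y) (map (ψ x) p)) ⟩
      reverse (reverse (map (ψ y) (map (ψ x) p)))    ≡⟨ reverse-involutive _ ⟩
      map (ψ y) (map (ψ x) p)                        ≡⟨ map-∘ p ⟨
      map (ψ y ∘ ψ x) p                              ∎
      where open ≡-Reasoning
    lem : ∀ k x y → y - (x - k) ≡ k + (y - x)
    lem = solve-∀
    tr : ∀ k → + ψ y (ψ x k) ≈ + k + (+ (2 ℕ.* y) - + (2 ℕ.* x))
    tr k = ≈-trans (ψ-≈ y (ψ x k)) (≈-trans (+-congˡ (+ (2 ℕ.* y)) (neg-cong (ψ-≈ x k)))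
      (≈-reflexive (lem (+ k) (+ (2 ℕ.* x)) (+ (2 ℕ.* y)))))

  κ-factorAt : ∀ u i n → κ (factorAt u i n) ≡ applyUpTo (λ t → difference (u i) (u (i ℕ.+ t))) n
  κ-factorAt u i n = trans (cong κ (factorAt-applyUpTo u i n)) (trans (κ-applyUpTo n)
    (cong (λ h → applyUpTo (λ t → difference (u h) (u (i ℕ.+ t))) n) (ℕ.+-identityʳ i)))
    where
    w : ℕ → ℕ
    w t = u (i ℕ.+ t)
    κ-applyUpTo : ∀ n → κ (applyUpTo w n) ≡ applyUpTo (difference (w 0) ∘ w) n
    κ-applyUpTo zero    = refl
    κ-applyUpTo (suc n) = map-applyUpTo w (difference (w 0)) (suc n)

  κ-factorAt-injective : ∀ u {j L a L′} → κ (factorAt u j L) ≡ κ (factorAt u a L′) →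
    L ≡ L′ × (∀ t → t ℕ.< L → + u (j ℕ.+ t) - + u j ≈ + u (a ℕ.+ t) - + u a)
  κ-factorAt-injective u {j} {L} {a} {L′} eq
    with applyUpTo-injective L L′ (trans (sym (κ-factorAt u j L)) (trans eq (κ-factorAt u a L′)))
  ... | L≡L′ , same = L≡L′ , λ t t<L → ≈-trans (≈-sym (difference-≈ (u j) (u (j ℕ.+ t))))
    (≈-trans (≈-reflexive (cong +_ (same t t<L))) (difference-≈ (u a) (u (a ℕ.+ t))))

  -- Being fixed by the antimorphism with parameter 2x means that mirrored letters add up to 2x. The
  -- sum is therefore required in the form `+ 2 * C`, and x is `C` reduced modulo `m`.
  factorAt-isGPal : ∀ u a L C → (∀ n → u n ℕ.< m) →
    (∀ x y → suc (x ℕ.+ y) ≡ L → + u (a ℕ.+ x) + + u (a ℕ.+ y) ≈ + 2 * C) → IsGPal m (factorAt u a L)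
  factorAt-isGPal u a L C u<m sum = Any.map⁺ (lose (∈-upTo⁺ (n%ℕd<d C m)) fix)
    where
    x₀ = C %ℕ m
    w : ℕ → ℕ
    w t = u (a ℕ.+ t)
    letter : ∀ x y → suc (x ℕ.+ y) ≡ L → ψ x₀ (w x) ≡ w y
    letter x y eq = ≈⇒≡ (modN-< (2 ℕ.* x₀ ℕ.+ (m ℕ.∸ modN m (w x)))) (u<m (a ℕ.+ y)) (≈-trans (ψ-≈ x₀ (w x))
      (≈-trans (+-congʳ (- + w x) (≈-trans (≈-reflexive (ℤ.pos-* 2 x₀)) (≈-trans (*-congˡ (+ 2) (%ℕ-≈ C)) (≈-sym (sum x y eq)))))
        (≈-reflexive (lem (+ w x) (+ w y)))))
      where
      lem : ∀ x y → x + y - x ≡ y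
      lem = solve-∀
    fix : reverse (map (ψ x₀) (factorAt u a L)) ≡ factorAt u a L
    fix = begin
      reverse (map (ψ x₀) (factorAt u a L))  ≡⟨ cong (reverse ∘ map (ψ x₀)) (factorAt-applyUpTo u a L) ⟩
      reverse (map (ψ x₀) (applyUpTo w L))   ≡⟨ cong reverse (map-applyUpTo w (ψ x₀) L) ⟩
      reverse (applyUpTo (ψ x₀ ∘ w) L)       ≡⟨ reverse-applyUpTo (ψ x₀ ∘ w) L ⟩
      applyDownFrom (ψ x₀ ∘ w) L             ≡⟨ applyDownFrom-reflect L letter ⟩
      applyUpTo w L                          ≡⟨ factorAt-applyUpTo u a L ⟨
      factorAt u a L                         ∎
      where open ≡-Reasoning

-- Bounding the defect by counting along prefixes.

module Counting (m′ : ℕ) (u : Word) (u-< : ∀ n → u n ℕ.< suc m′) where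
  open Orbits m′

  FreshPal : ℕ → ℕ → Set
  FreshPal i e = ∃₂ λ a L → i ℕ.≤ a × a ℕ.+ L ≡ suc e × IsGPal m (factorAt u a L) ×
    (∀ j → i ℕ.≤ j → j ℕ.< a → κ (factorAt u j L) ≢ κ (factorAt u a L))

  -- A position contributing no orbit is charged to a value of `Y` below `K` appearing for the first
  -- time, so at most `K` positions are charged.
  NewValue : Word → ℕ → ℕ → ℕ → Set
  NewValue Y K i e = Y e ℕ.< K × (∀ j → i ℕ.≤ j → j ℕ.< e → Y j ≢ Y e)

  Key : ℕ → ℕ → List ℕ → Set
  Key i n k = ∃₂ λ j L → i ℕ.≤ j × j ℕ.+ L ℕ.≤ i ℕ.+ n × IsGPal m (factorAt u j L) × k ≡ κ (factorAt u j L)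

  Value : Word → ℕ → ℕ → ℕ → ℕ → Set
  Value Y K i n y = ∃ λ j → i ℕ.≤ j × j ℕ.< i ℕ.+ n × y ≡ Y j × y ℕ.< K

  weakenKey : ∀ {i n k} → Key i n k → Key i (suc n) k
  weakenKey {i} {n} (j , L , i≤j , hi , rest) = j , L , i≤j , ℕ.≤-trans hi (ℕ.+-monoʳ-≤ i (ℕ.n≤1+n n)) , rest

  weakenValue : ∀ {Y K i n y} → Value Y K i n y → Value Y K i (suc n) y
  weakenValue {i = i} {n} (j , i≤j , hi , rest) = j , i≤j , ℕ.≤-trans hi (ℕ.+-monoʳ-≤ i (ℕ.n≤1+n n)) , rest

  keys≤numPal : ∀ {i n ks} → Unique ks → All (Key i n) ks → length ks ℕ.≤ numPal m (factorAt u i n)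
  keys≤numPal {i} {n} {ks} uniq keys = ℕ.≤-trans (unique-⊆⇒length≤ uniq sub) (ℕ.≤-reflexive (length-map κ (deduplicate (sameOrbit? m) pals)))
    where
    pals : List (List ℕ)
    pals = filter (isGPal? m) (factors (factorAt u i n))
    sub : ∀ {k} → k ∈ ks → k ∈ map κ (deduplicate (sameOrbit? m) pals)
    sub k∈ with All.lookup keys k∈
    ... | j , L , i≤j , hi , pal , refl = ∈-map-deduplicate (sameOrbit? m) κ κ-orbit
      (All.tabulate (λ p∈ → proj₂ (∈-filter⁻ (isGPal? m) {xs = factors (factorAt u i n)} p∈)))
      (∈-filter⁺ (isGPal? m) (∈-factors-factorAt u i≤j hi) pal)

  module _ (Y : Word) (K i : ℕ) (step : ∀ e → i ℕ.≤ e → FreshPal i e ⊎ NewValue Y K i e) where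

    -- The empty word provides the first key, and each further position adds one new key or one new
    -- value.
    collect : ∀ n → ∃₂ λ ks ys → Unique ks × Unique ys × All (Key i n) ks × All (Value Y K i n) ys ×
      length ks ℕ.+ length ys ≡ suc n
    collect zero = κ (factorAt u i 0) ∷ [] , [] , [] ∷ [] , [] , (i , 0 , ℕ.≤-refl , ℕ.≤-refl , empty , refl) ∷ [] , [] , refl
      where
      empty : IsGPal m (factorAt u i 0)
      empty = factorAt-isGPal u i 0 0ℤ u-< (λ _ _ ())
    collect (suc n) with collect n | step (i ℕ.+ n) (ℕ.m≤m+n i n)
    ... | ks , ys , uks , uys , keys , values , count | inj₁ (a , L , i≤a , aL , pal , new) =
      κ (factorAt u a L) ∷ ks , ys , All.map apart keys ∷ uks , uys ,
      (a , L , i≤a , ℕ.≤-reflexive (trans aL (sym (ℕ.+-suc i n))) , pal , refl) ∷ All.map (weakenKey {i} {n}) keys ,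
      All.map (weakenValue {Y} {K} {i} {n}) values , cong suc count
      where
      apart : ∀ {k} → Key i n k → κ (factorAt u a L) ≢ k
      -- Equal keys have equal lengths, and the earlier factor ends before position `i + n`, so it
      -- starts before `a`.
      apart (j , L′ , i≤j , hi , _ , refl) eq with proj₁ (κ-factorAt-injective u {a} {L} {j} {L′} eq)
      ... | refl = new j i≤j (ℕ.+-cancelʳ-< L j a (ℕ.≤-trans (s≤s hi) (ℕ.≤-reflexive (sym aL)))) (sym eq)
    ... | ks , ys , uks , uys , keys , values , count | inj₂ (small , new) =
      ks , Y (i ℕ.+ n) ∷ ys , uks , All.map apart values ∷ uys , All.map (weakenKey {i} {n}) keys ,
      (i ℕ.+ n , ℕ.m≤m+n i n , ℕ.≤-reflexive (sym (ℕ.+-suc i n)) , refl , small) ∷ All.map (weakenValue {Y} {K} {i} {n}) values ,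
      trans (ℕ.+-suc (length ks) (length ys)) (cong suc count)
      where
      apart : ∀ {y} → Value Y K i n y → Y (i ℕ.+ n) ≢ y
      apart (j , i≤j , hi , refl , _) eq = new j i≤j hi (sym eq)

    -- Of the `n + 1` collected items at most `numPal` are keys and, being distinct numbers below
    -- `K`, at most `K` are values.
    defect-bound : ∀ n → defect m (factorAt u i n) ℤ.≤ + K
    defect-bound n with collect n
    ... | ks , ys , uks , uys , keys , values , count = begin
      + (length w ℕ.+ 1) - + numPal m w - + gamma m w
        ≤⟨ ℤ.i-j≤i _ (+ gamma m w) ⟩
      + (length w ℕ.+ 1) - + numPal m w
        ≤⟨ ℤ.+-monoˡ-≤ (- + numPal m w) (ℤ.+≤+ enough) ⟩
      + (numPal m w ℕ.+ K) - + numPal m w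
        ≡⟨ cong (_- + numPal m w) (ℤ.pos-+ (numPal m w) K) ⟩
      + numPal m w + + K - + numPal m w
        ≡⟨ cancel (+ numPal m w) (+ K) ⟩
      + K ∎
      where
      open ℤ.≤-Reasoning
      w = factorAt u i n
      cancel : ∀ x y → x + y - x ≡ y
      cancel = solve-∀
      few : length ys ℕ.≤ K
      few = ℕ.≤-trans (unique-⊆⇒length≤ uys (λ y∈ → let _ , _ , _ , _ , y<K = All.lookup values y∈ in ∈-upTo⁺ y<K))
        (ℕ.≤-reflexive (length-upTo K))
      enough : length w ℕ.+ 1 ℕ.≤ numPal m w ℕ.+ K
      enough = ℕ.≤-trans (ℕ.≤-reflexive (trans (ℕ.+-comm (length w) 1)
          (trans (cong suc (trans (length-map _ (upTo n)) (length-upTo n))) (sym count))))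
        (ℕ.+-mono-≤ (keys≤numPal {i} {n} uks keys) few)

-- The word S(t): from palindromes of `V` to G-palindromes of `u`.

module ThueMorse (c : ℕ) (2≤c : 2 ℕ.≤ c) (m′ : ℕ) where
  open Blocks c using (b)
  open Orbits m′
  open Congruence m
  open Carries c 2≤c m
  open Window _≈_ V

  u : Word
  u = S m (tbm b m)

  u-< : ∀ n → u n ℕ.< m
  u-< n = modN-< (tbm b m n ℕ.+ tbm b m (suc n))

  open Counting m′ u u-<

  u-≈ : ∀ n → + u n ≈ + s n + + s (suc n)
  u-≈ n = ≈-trans (modN-≈ (tbm b m n ℕ.+ tbm b m (suc n)))
    (≈-trans (≈-reflexive (ℤ.pos-+ (tbm b m n) (tbm b m (suc n)))) (+-cong (modN-≈ (s n)) (modN-≈ (s (suc n)))))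

  u-difference : ∀ n → + u (suc n) - + u n ≈ + 2 - D n
  u-difference n = ≈-trans (+-cong (u-≈ (suc n)) (neg-cong (u-≈ n))) (≈-reflexive (lem (+ s n) (+ s (suc n)) (+ s (suc (suc n)))))
    where
    lem : ∀ x y z → y + z - (x + y) ≡ + 2 - ((1ℤ + x - y) + (1ℤ + y - z))
    lem = solve-∀

  -- `V x ≈ V y` says that `s (suc x) + s y` and `s x + s (suc y)` agree, so the four digit sums add
  -- up to twice either of them.
  u-sum : ∀ {x y} → V x ≈ V y → + u x + + u y ≈ + 2 * (+ s x + + s (suc y))
  u-sum {x} {y} p = ≈-trans (+-cong (u-≈ x) (u-≈ y))
    (≈-trans (≈-reflexive (lem (+ s x) (+ s (suc x)) (+ s y) (+ s (suc y))))
    (≈-trans (+-congˡ (+ 2 * (+ s x + + s (suc y))) (+-congʳ (- V x) (≈-sym p)))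
      (≈-reflexive (lem′ (+ 2 * (+ s x + + s (suc y))) (V x)))))
    where
    lem : ∀ x x′ y y′ → x + x′ + (y + y′) ≡ + 2 * (x + y′) + ((1ℤ + y - y′) - (1ℤ + x - x′))
    lem = solve-∀
    lem′ : ∀ x y → x + (y - y) ≡ x
    lem′ = solve-∀

  -- Moving both arguments one step inwards changes the sum by a difference of mirrored letters of
  -- `V`, which vanishes.
  palindromic⇒constant-sum : ∀ {a e} → Palindromic a e → ∀ x y → x ℕ.+ y ≡ e → a ℕ.≤ y →
    + s (a ℕ.+ x) + + s (suc y) ≈ + s a + + s (suc e)
  palindromic⇒constant-sum {a} pal zero    y refl a≤y = ≈-reflexive (cong (λ n → + s n + + s (suc y)) (ℕ.+-identityʳ a))
  palindromic⇒constant-sum {a} {e} pal (suc x) y eq a≤y =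
    subst (λ n → + s n + + s (suc y) ≈ + s a + + s (suc e)) (sym (ℕ.+-suc a x))
      (≈-trans (≈-reflexive (lem (+ s (a ℕ.+ x)) (+ s (suc (a ℕ.+ x))) (+ s (suc y)) (+ s (suc (suc y)))))
      (≈-trans (+-cong (palindromic⇒constant-sum pal x (suc y) (trans (ℕ.+-suc x y) eq) (ℕ.m≤n⇒m≤1+n a≤y))
                       (+-congʳ (- V (a ℕ.+ x)) (≈-sym mirror)))
               (≈-reflexive (lem′ (+ s a + + s (suc e)) (V (a ℕ.+ x))))))
    where
    mirror : V (a ℕ.+ x) ≈ V (suc y)
    mirror = pal (a ℕ.+ x) (suc y) (ℕ.m≤m+n a x) (ℕ.m≤n⇒m≤1+n a≤y)
      (trans (ℕ.+-assoc a x (suc y)) (cong (a ℕ.+_) (trans (ℕ.+-suc x y) eq)))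
    lem : ∀ x x′ y y′ → x′ + y ≡ x + y′ + ((1ℤ + y - y′) - (1ℤ + x - x′))
    lem = solve-∀
    lem′ : ∀ x y → x + (y - y) ≡ x
    lem′ = solve-∀

  palindromic⇒isGPal : ∀ {a e L} → a ℕ.+ L ≡ suc e → Palindromic a e → IsGPal m (factorAt u a L)
  palindromic⇒isGPal {a} {e} {L} aL pal = factorAt-isGPal u a L (+ s a + + s (suc e)) u-< sum
    where
    sum : ∀ x y → suc (x ℕ.+ y) ≡ L → + u (a ℕ.+ x) + + u (a ℕ.+ y) ≈ + 2 * (+ s a + + s (suc e))
    sum x y refl = ≈-trans (u-sum (pal (a ℕ.+ x) (a ℕ.+ y) (ℕ.m≤m+n a x) (ℕ.m≤m+n a y)
                          (trans (ℕ.+-assoc a x (a ℕ.+ y)) (cong (a ℕ.+_) x+ay))))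
      (*-congˡ (+ 2) (palindromic⇒constant-sum pal x (a ℕ.+ y) x+ay (ℕ.m≤m+n a y)))
      where
      x+ay : x ℕ.+ (a ℕ.+ y) ≡ e
      x+ay = trans (x∙yz≈y∙xz x a y) (ℕ.suc-injective (trans (sym (ℕ.+-suc a (x ℕ.+ y))) aL))

  -- Equal keys mean equal differences to the first letter, hence equal consecutive differences,
  -- which are `+ 2 - D`; `L` letters have `L - 1` of these.
  κ-≡⇒D-≈ : ∀ {j a L} → κ (factorAt u j L) ≡ κ (factorAt u a L) →
    ∀ t → suc t ℕ.< L → D (j ℕ.+ t) ≈ D (a ℕ.+ t)
  κ-≡⇒D-≈ {j} {a} {L} eq t t<L = by (lem (D (j ℕ.+ t)) (D (a ℕ.+ t))) (divisible (neg-cong flipped))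
    where
    rel = proj₂ (κ-factorAt-injective u {j} {L} {a} {L} eq)
    lem : ∀ x y → x - y ≡ - (+ 2 - x) - - (+ 2 - y)
    lem = solve-∀
    tele : ∀ x y z → x - z - (y - z) ≡ x - y
    tele = solve-∀
    increments : + u (suc (j ℕ.+ t)) - + u (j ℕ.+ t) ≈ + u (suc (a ℕ.+ t)) - + u (a ℕ.+ t)
    increments = ≈-trans (≈-reflexive (sym (tele (+ u (suc (j ℕ.+ t))) (+ u (j ℕ.+ t)) (+ u j))))
      (≈-trans (+-cong (subst₂ (λ x y → + u x - + u j ≈ + u y - + u a) (ℕ.+-suc j t) (ℕ.+-suc a t) (rel (suc t) t<L))
                       (neg-cong (rel t (ℕ.<⇒≤ t<L))))
        (≈-reflexive (tele (+ u (suc (a ℕ.+ t))) (+ u (a ℕ.+ t)) (+ u a))))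
    flipped : + 2 - D (j ℕ.+ t) ≈ + 2 - D (a ℕ.+ t)
    flipped = ≈-trans (≈-sym (u-difference (j ℕ.+ t))) (≈-trans increments (u-difference (a ℕ.+ t)))

  NewLetter : ℕ → ℕ → Set
  NewLetter i e = ∀ j → i ℕ.≤ j → j ℕ.< e → ¬ V j ≈ V e

  -- A fresh suffix of length one is exactly a new letter of `V`; a longer one keeps its freshness
  -- on passing to `D` and so to keys.
  freshPal⊎newLetter : ∀ i e → i ℕ.≤ e → FreshPal i e ⊎ NewLetter i e
  freshPal⊎newLetter i e i≤e with freshSuffix i e i≤e
  ... | a , i≤a , a≤e , pal , new with ℕ.m≤n⇒m<n∨m≡n a≤e
  ...   | inj₂ refl = inj₂ λ j i≤j j<a p → new j i≤j j<a λ t a+t≤a →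
          let t≡0 = ℕ.n≤0⇒n≡0 (ℕ.+-cancelˡ-≤ a t 0 (ℕ.≤-trans a+t≤a (ℕ.≤-reflexive (sym (ℕ.+-identityʳ a))))) in
          subst (λ t → V (j ℕ.+ t) ≈ V (a ℕ.+ t)) (sym t≡0)
            (subst₂ (λ x y → V x ≈ V y) (sym (ℕ.+-identityʳ j)) (sym (ℕ.+-identityʳ a)) p)
  ...   | inj₁ a<e = inj₁ (a , suc e ℕ.∸ a , i≤a , aL , palindromic⇒isGPal aL pal , λ j i≤j j<a eq →
          new j i≤j j<a (D-recurs⇒recurs pal a<e (λ t a+t<e → κ-≡⇒D-≈ eq t (inside t a+t<e))))
    where
    aL : a ℕ.+ (suc e ℕ.∸ a) ≡ suc e
    aL = ℕ.m+[n∸m]≡n (ℕ.m≤n⇒m≤1+n a≤e)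
    inside : ∀ t → suc (a ℕ.+ t) ℕ.≤ e → suc t ℕ.< suc e ℕ.∸ a
    inside t p = ℕ.+-cancelˡ-< a (suc t) (suc e ℕ.∸ a)
      (ℕ.≤-trans (s≤s (ℕ.≤-trans (ℕ.≤-reflexive (ℕ.+-suc a t)) p)) (ℕ.≤-reflexive (sym aL)))

  -- The bound is the number of residues available to new letters of `V`.
  almostRich : AlmostRich m u
  almostRich = m , λ i → defect-bound (λ n → V n %ℕ m) m i (step i)
    where
    step : ∀ i e → i ℕ.≤ e → FreshPal i e ⊎ NewValue (λ n → V n %ℕ m) m i e
    step i e i≤e with freshPal⊎newLetter i e i≤e
    ... | inj₁ p = inj₁ p
    ... | inj₂ new = inj₂ (n%ℕd<d (V e) m , λ j i≤j j<e eq →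
          new j i≤j j<e (≈-trans (≈-sym (%ℕ-≈ (V j))) (≈-trans (≈-reflexive (cong +_ eq)) (%ℕ-≈ (V e)))))

  rich : ∃ (λ d → + c ≈ + 2 * d) → Rich m u
  -- With `K` equal to 0 no position may be charged, so new letters must yield orbits as well.
  rich half i = defect-bound (λ _ → 0) 0 i (λ e i≤e → inj₁ ([ (λ p → p) , letter e i≤e ]′ (freshPal⊎newLetter i e i≤e)))
    where
    -- If V e is new then so is D at the last two positions, which form a G-palindrome because c is even modulo m.
    letter : ∀ e → i ℕ.≤ e → NewLetter i e → FreshPal i e
    letter e i≤e new with ℕ.m≤n⇒m<n∨m≡n i≤e
    -- At the first position of the window the single letter is a G-palindrome, with centre given by
    -- `+ u e`.
    letter e i≤e new | inj₂ refl = e , 1 , ℕ.≤-refl , ℕ.+-comm e 1 , single ,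
      λ j i≤j j<e → contradiction i≤j (ℕ.<⇒≱ j<e)
      where
      single : IsGPal m (factorAt u e 1)
      single = factorAt-isGPal u e 1 (+ u e) u-< λ { zero zero _ → ≈-reflexive (twice (ℕ.+-identityʳ e)) }
        where
        dbl : ∀ x → x + x ≡ + 2 * x
        dbl = solve-∀
        twice : ∀ {n} → n ≡ e → + u n + + u n ≡ + 2 * + u e
        twice refl = dbl (+ u e)
    letter (suc e) i≤e new | inj₁ (s≤s i≤e′) = e , 2 , i≤e′ , ℕ.+-comm e 2 , pair , fresh
      where
      fresh : ∀ j → i ℕ.≤ j → j ℕ.< e → κ (factorAt u j 2) ≢ κ (factorAt u e 2)
      fresh j i≤j j<e eq = D-fresh new j i≤j j<e
        (subst₂ (λ x y → D x ≈ D y) (ℕ.+-identityʳ j) (ℕ.+-identityʳ e) (κ-≡⇒D-≈ eq 0 (s≤s (s≤s z≤n))))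
      h₁ = V-halves half e
      h₂ = V-halves half (suc e)
      C : ℤ
      -- Half of `2 u(e) + 2 - D(e)`, where `D e` is twice the sum of the two halves.
      C = + u e + 1ℤ - (proj₁ h₁ + proj₁ h₂)
      sum : + u e + + u (suc e) ≈ + 2 * C
      sum = ≈-trans (≈-reflexive (lem (+ u e) (+ u (suc e))))
        (≈-trans (+-congˡ (+ u e + + u e) (≈-trans (u-difference e)
          (+-congˡ (+ 2) (neg-cong (+-cong (proj₂ h₁) (proj₂ h₂))))))
        (≈-reflexive (lem′ (+ u e) (proj₁ h₁) (proj₁ h₂))))
        where
        lem : ∀ x y → x + y ≡ x + x + (y - x)
        lem = solve-∀
        lem′ : ∀ x d d′ → x + x + (+ 2 - (+ 2 * d + + 2 * d′)) ≡ + 2 * (x + 1ℤ - (d + d′))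
        lem′ = solve-∀
      pair : IsGPal m (factorAt u e 2)
      pair = factorAt-isGPal u e 2 C u-< λ
        { zero (suc zero) _ → subst₂ (λ x y → + u x + + u y ≈ + 2 * C) (sym (ℕ.+-identityʳ e)) (ℕ.+-comm 1 e) sum
        ; (suc zero) zero _ → subst₂ (λ x y → + u x + + u y ≈ + 2 * C) (ℕ.+-comm 1 e) (sym (ℕ.+-identityʳ e))
            (≈-trans (≈-reflexive (ℤ.+-comm (+ u (suc e)) (+ u e))) sum) }

  -- For `m = 1 + 2 q`, adding `c * m` to `c` gives `2 c (1 + q)`; for odd `b`, `c = b - 1` is
  -- itself even.
  odd⇒half : Odd m ⊎ Odd b → ∃ λ d → + c ≈ + 2 * d
  odd⇒half (inj₁ odd) = + c * (1ℤ + + q) , ≈-trans (≈-reflexive (sym (ℤ.+-identityʳ (+ c))))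
      (≈-trans (+-congˡ (+ c) (≈-sym (multiple≈0 (+ c)))) (≈-reflexive (trans (cong (λ x → + c + + c * x) m≡) (lem (+ c) (+ q)))))
    where
    q = m ℕ./ 2
    m≡ : + m ≡ 1ℤ + + q * + 2
    m≡ = trans (cong +_ (trans (ℕ.m≡m%n+[m/n]*n m 2) (cong (ℕ._+ q ℕ.* 2) odd)))
      (trans (ℤ.pos-+ 1 (q ℕ.* 2)) (cong (_+_ 1ℤ) (ℤ.pos-* q 2)))
    lem : ∀ c q → c + c * (1ℤ + q * + 2) ≡ + 2 * (c * (1ℤ + q))
    lem = solve-∀
  odd⇒half (inj₂ odd) = + q , ≈-reflexive (trans (cong +_ (ℕ.suc-injective (trans (ℕ.m≡m%n+[m/n]*n b 2)
      (trans (cong (ℕ._+ q ℕ.* 2) odd) (cong suc (ℕ.*-comm q 2)))))) (ℤ.pos-* 2 q))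
    where
    q = b ℕ./ 2

mainTheorem2 : (m b : ℕ) → 3 ≤ m → 3 ≤ b →
    AlmostRich m (S m (tbm b m))
    × ((Odd m ⊎ Odd b) → Rich m (S m (tbm b m)))
mainTheorem2 (suc m′) (suc c) _ (s≤s 2≤c) = almostRich , λ odd → rich (odd⇒half odd)
  where open ThueMorse c 2≤c m′
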